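{- Let $k,\ell,r\in\mathbb{N}$ with $\ell\leq k$ and $k\geq2$. Then $S_r(k;\ell)$ exists if and only if $\ell\geq2$ or $r=1$.
   Context: $\mathbb{N}=\{1,2,\ldots\}$ is the set of positive integers. For $n,r\in\mathbb{N}$, an $r$-coloring of $\{1,\ldots,n\}$ is a function $\Delta:\{1,\ldots,n\}\to\{1,\ldots,r\}$. For $k\geq 2$ consider the equation \[ x_1+x_2+\cdots+x_k=x_{k+1}\qquad(*) \] in which the variables are not required to be distinct. A solution $\mathcal{S}$ to $(*)$ in $\{1,\ldots,n\}$ (i.e. a tuple $(x_1,\ldots,x_{k+1})$ of elements of $\{1,\ldots,n\}$ satisfying $(*)$) is monochromatic under $\Delta$ if all integers occurring in it have the same color. For a solution $\mathcal{S}$, $c(\mathcal{S})$ denotes the number of distinct integers occurring among $x_1,\ldots,x_{k+1}$. For $r,k,\ell\in\mathbb{N}$ with $\ell\leq k$ and $k\geq2$, $S_r(k;\ell)$ denotes the smallest $n\in\mathbb{N}$, if it exists, such that every $r$-coloring of $\{1,2,\ldots,n\}$ has a monochromatic solution $\mathcal{S}$ to $(*)$ with $c(\mathcal{S})=\ell+1$; "$S_r(k;\ell)$ exists" means that at least one such $n$ exists. -}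

module Defs where

open import Data.Nat using (ℕ; suc; _≤_)
open import Data.Fin using (Fin; toℕ)
open import Data.Fin.Properties using (_≟_)
open import Data.List using (List; _∷_; length; deduplicate)
open import Data.List.Relation.Unary.All using (All)
open import Data.Product using (∃-syntax; Σ-syntax; _×_)
open import Data.Vec using (Vec; map; sum; toList)
open import Relation.Binary.PropositionalEquality using (_≡_)

-- The set {1,…,n} is represented by Fin n, with i standing for the
-- positive integer toℕ i + 1.
value : ∀ {n} → Fin n → ℕ
value i = suc (toℕ i)

-- Since only equality of colors matters, the colors 1,…,r are Fin r.
Coloring : ℕ → ℕ → Set
Coloring r n = Fin n → Fin r

-- A tuple (x₁,…,xₖ₊₁) in {1,…,n} with x₁ + ⋯ + xₖ = xₖ₊₁; summands is
-- (x₁,…,xₖ) and total is xₖ₊₁.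
record Solution (k n : ℕ) : Set where
  field
    summands : Vec (Fin n) k
    total    : Fin n
    equation : sum (map value summands) ≡ value total

  entries : List (Fin n)
  entries = total ∷ toList summands

open Solution public

Monochromatic : ∀ {r k n} → Coloring r n → Solution k n → Set
Monochromatic Δ S = ∃[ color ] All (λ i → Δ i ≡ color) (entries S)

c : ∀ {k n} → Solution k n → ℕ
c S = length (deduplicate _≟_ (entries S))

-- The property of n whose least positive witness is S_r(k;ℓ).
Forces : (r k ℓ n : ℕ) → Set
Forces r k ℓ n =
  (Δ : Coloring r n) → Σ[ S ∈ Solution k n ] (Monochromatic Δ S × c S ≡ suc ℓ)

-- Existence of S_r(k;ℓ) means that some positive n has this property.
S-Exists : (r k ℓ : ℕ) → Set
S-Exists r k ℓ = ∃[ n ] (1 ≤ n × Forces r k ℓ n)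

{-# OPTIONS --safe #-}
module Submission where

-- If ℓ = 1, then all summands equal some x and the total is k * x; coloring x
-- by the parity of the exponent of k in x forbids this as soon as r ≥ 2.
--
-- If ℓ ≥ 2, iterate van der Waerden's theorem: take a long monochromatic
-- progression with step d, put x₁ on it, and repeat inside the multiples of d
-- that are small enough for x₁ plus any of them to stay on the progression.
-- This gives x₁ > x₂ > … such that the color of xᵢ plus a combination of later
-- terms with small coefficients depends on i only. By the pigeonhole principle
-- ℓ of the xᵢ have the same color. Keeping only these, the summands are
-- x₁, …, x_ℓ with x₂ repeated k − ℓ more times: the total is x₁ plus a
-- combination of later terms.

open import Data.Bool using (Bool; true; false; not)
open import Data.Bool.Properties using (not-¬)
open import Data.Empty using (⊥-elim)
open import Data.Fin using (Fin; zero; suc; toℕ; fromℕ<; funToFin; finToFun)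
open import Data.Fin.Properties
  using (_≟_; any?; <⇒notInjective; toℕ-fromℕ<; finToFun-funToFin)
open import Data.List as List
  using (List; []; _∷_; _++_; length; deduplicate; filter; replicate; allFin; take)
open import Data.List.Properties
  using (filter-all; filter-idem; filter-reject; length-++; length-map; length-replicate;
         length-tabulate; length-take; map-++; map-id-local; map-replicate; map-∘)
open import Data.List.Membership.Propositional using (_∈_)
open import Data.List.Membership.Propositional.Properties
  using (∈-allFin; ∈-deduplicate⁺; ∈-filter⁺; ∈-map⁻; ∈-++⁺ʳ)
open import Data.List.Relation.Binary.Sublist.Propositional
  using (_⊆_; []; _∷_; _∷ʳ_; ⊆-trans)
import Data.List.Relation.Binary.Sublist.Propositional.Properties as Sublist
open import Data.List.Relation.Unary.All as All using (All; []; _∷_)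
import Data.List.Relation.Unary.All.Properties as All
open import Data.List.Relation.Unary.AllPairs as AllPairs using (AllPairs; []; _∷_)
open import Data.List.Relation.Unary.Any using (here; there)
open import Data.List.Relation.Unary.Unique.Propositional using (Unique)
import Data.List.Relation.Unary.Unique.Propositional.Properties as Unique
open import Data.Nat hiding (_≟_)
open import Data.Nat.Divisibility using (_∣?_; divides; m∣m*n)
open import Data.Nat.ListAction using (sum)
open import Data.Nat.Properties hiding (_≟_)
open import Data.Nat.Tactic.RingSolver using (solve-∀)
open import Data.Product using (∃-syntax; Σ-syntax; _×_; _,_; proj₁; proj₂; map₂)
open import Data.Sum using (_⊎_; inj₁; inj₂)
open import Data.Vec as Vec using (Vec; []; _∷_)
open import Data.Vec.Functional using () renaming (_∷_ to _◂_)
import Data.Vec.Properties as Vec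
open import Function using (_∘_; id)
open import Function.Bundles using (_⇔_; mk⇔)
open import Function.Definitions using (Injective)
open import Relation.Binary.PropositionalEquality
open import Relation.Nullary using (¬_; Dec; yes; no; does; ¬?; contradiction)
open import Defs

-- Van der Waerden's theorem

Mono : ∀ {r} → (ℕ → Fin r) → Fin r → (x d len : ℕ) → Set
Mono Δ κ x d len = ∀ {t} → t < len → Δ (x + t * d) ≡ κ

-- The bound reaches one step past the last term, so that even a progression of one term has gap at
-- most `N`.
record MonoAP {r} (Δ : ℕ → Fin r) (len N : ℕ) : Set where
  constructor ap
  field
    {first gap} : ℕ
    {color}     : Fin r
    gap>0       : 0 < gap
    bounded     : first + len * gap ≤ N
    mono        : Mono Δ color first gap len

-- The color of `pre` is unconstrained. In a progression of blocks, `pre` is the block that receives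
-- the new focus.
record MonoAPWithPredecessor {r} (Δ : ℕ → Fin r) (len N : ℕ) : Set where
  constructor ap⁻
  field
    {pre gap} : ℕ
    {color}   : Fin r
    gap>0     : 0 < gap
    bounded   : pre + suc len * gap ≤ N
    mono      : Mono Δ color (pre + gap) gap len

-- s monochromatic progressions of distinct colors, all of which would be
-- extended downwards by the same number, the focus.
record Fan {r} (Δ : ℕ → Fin r) (len s N : ℕ) : Set where
  field
    focus         : ℕ
    gap           : Fin s → ℕ
    color         : Fin s → Fin r
    gap>0         : ∀ i → 0 < gap i
    bounded       : ∀ i → focus + suc len * gap i ≤ N
    focus-bounded : focus ≤ N
    distinct      : Injective _≡_ _≡_ color
    mono          : ∀ i → Mono Δ (color i) (focus + gap i) (gap i) len

VanDerWaerden : ℕ → Set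
VanDerWaerden len =
  ∀ r → ∃[ N ] ∀ (Δ : ℕ → Fin r) → MonoAP Δ len N

-- A progression found in the coloring shifted by `N` has gap at most `N`, so there is room for one
-- more step to its left.
predecessor : ∀ {len} → VanDerWaerden (suc len) → ∀ r →
  ∃[ N ] ∀ (Δ : ℕ → Fin r) → MonoAPWithPredecessor Δ (suc len) N
predecessor {len} vdW r with vdW r
... | N , find = N + N , shifted
  where
  shifted : ∀ Δ → MonoAPWithPredecessor Δ (suc len) (N + N)
  shifted Δ with find (λ i → Δ (N + i))
  ... | ap {first} {d} d>0 bounded mono =
    ap⁻ {pre = N + first ∸ d} d>0
      (begin
        N + first ∸ d + suc (suc len) * d    ≡⟨ +-assoc (N + first ∸ d) d _ ⟨
        N + first ∸ d + d + suc len * d      ≡⟨ cong (_+ suc len * d) back ⟩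
        N + first + suc len * d              ≡⟨ +-assoc N first _ ⟩
        N + (first + suc len * d)            ≤⟨ +-monoʳ-≤ N bounded ⟩
        N + N                                ∎)
      (λ {t} t< → trans
        (cong Δ (trans (cong (_+ t * d) back) (+-assoc N first _)))
        (mono t<))
    where
    open ≤-Reasoning
    d≤N : d ≤ N
    d≤N = ≤-trans (m≤m+n d (len * d)) (≤-trans (m≤n+m _ first) bounded)
    back : N + first ∸ d + d ≡ N + first
    back = m∸n+n≡m (≤-trans d≤N (m≤m+n N first))

-- The coloring of a whole block is encoded as a single color out of `r ^ W`, so that van der
-- Waerden's theorem applies to blocks.
block : ∀ {r} → (ℕ → Fin r) → (W : ℕ) → ℕ → Fin (r ^ W)
block Δ W b = funToFin {W} (λ i → Δ (toℕ i + b * W))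

block-agree : ∀ {r} (Δ : ℕ → Fin r) W {b b′ i} → block Δ W b ≡ block Δ W b′ →
  i < W → Δ (i + b * W) ≡ Δ (i + b′ * W)
block-agree Δ W {b} {b′} {i} eq i<W = begin
  Δ (i + b * W)                         ≡⟨ at b ⟨
  finToFun (block Δ W b) (fromℕ< i<W)   ≡⟨ cong (λ w → finToFun w (fromℕ< i<W)) eq ⟩
  finToFun (block Δ W b′) (fromℕ< i<W)  ≡⟨ at b′ ⟩
  Δ (i + b′ * W)                        ∎
  where
  open ≡-Reasoning
  at : ∀ b → finToFun (block Δ W b) (fromℕ< i<W) ≡ Δ (i + b * W)
  at b = trans (finToFun-funToFin {W} _ (fromℕ< i<W))
               (cong (λ j → Δ (j + b * W)) (toℕ-fromℕ< i<W))

◂-injective : ∀ {s} {A : Set} {a : A} {f : Fin s → A} →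
  (∀ i → f i ≢ a) → Injective _≡_ _≡_ f → Injective _≡_ _≡_ (a ◂ f)
◂-injective a∉f inj {zero}  {zero}  _  = refl
◂-injective a∉f inj {zero}  {suc j} eq = contradiction (sym eq) (a∉f j)
◂-injective a∉f inj {suc i} {zero}  eq = contradiction eq (a∉f i)
◂-injective a∉f inj {suc i} {suc j} eq = cong suc (inj eq)

AP-or-Fan : (r len s : ℕ) → Set
AP-or-Fan r len s =
  ∃[ N ] ∀ (Δ : ℕ → Fin r) → MonoAP Δ (suc len) N ⊎ Fan Δ len s N

-- Among consecutive blocks of length W, find blocks e + D, e + 2D, … with the
-- same coloring, and a fan inside that coloring. Moving its focus into block e
-- and lengthening its steps by D * W keeps the old spokes, and the copies of
-- the old focus form one more spoke.
add-spoke : ∀ {r len s} → VanDerWaerden (suc len) →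
  AP-or-Fan r (suc len) s → AP-or-Fan r (suc len) (suc s)
add-spoke {r} {l} {s} vdW (N , find) = N + V * W , extend
  where
  len = suc l
  -- Positions inside a block, the focus included, run from 0 to `N`.
  W = suc N
  V = proj₁ (predecessor vdW (r ^ W))

  extend : ∀ Δ → MonoAP Δ (suc len) (N + V * W) ⊎ Fan Δ len (suc s) (N + V * W)
  extend Δ with proj₂ (predecessor vdW (r ^ W)) (block Δ W)
  ... | ap⁻ {e} {D} D>0 e+D≤V same = result (find χ)
    where
    open ≤-Reasoning

    -- The common coloring of the repeated blocks, read off from the first of them.
    χ : ℕ → Fin r
    χ i = Δ (i + (e + D) * W)

    transfer : ∀ {t i} → t < len → i < W → Δ (i + (e + D + t * D) * W) ≡ χ i
    transfer {t} {i} t<len i<W = trans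
      -- Block `t` of the progression is compared with block 0, whose index computes to `e + D + 0`.
      (block-agree Δ W {e + D + t * D} {e + D + 0} (trans (same t<len) (sym (same z<s))) i<W)
      (cong (λ b → Δ (i + b * W)) (+-identityʳ (e + D)))

    eW≤VW : e * W ≤ V * W
    eW≤VW = *-monoˡ-≤ W (m+n≤o⇒m≤o e e+D≤V)

    e+D≤ : (e + D) * W ≤ V * W
    e+D≤ = *-monoˡ-≤ W (≤-trans (+-monoʳ-≤ e (m≤m+n D _)) e+D≤V)

    lift : MonoAP χ (suc len) N → MonoAP Δ (suc len) (N + V * W)
    lift (ap {c} {d} d>0 c≤N mono) = ap d>0
      (begin
        c + (e + D) * W + suc len * d    ≡⟨ swap c ((e + D) * W) _ ⟩
        c + suc len * d + (e + D) * W    ≤⟨ +-mono-≤ c≤N e+D≤ ⟩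
        N + V * W                        ∎)
      (λ {t} t< → trans (cong Δ (swap c ((e + D) * W) (t * d))) (mono t<))
      where
      swap : ∀ x y z → x + y + z ≡ x + z + y
      swap = solve-∀

    result : MonoAP χ (suc len) N ⊎ Fan χ len s N →
      MonoAP Δ (suc len) (N + V * W) ⊎ Fan Δ len (suc s) (N + V * W)
    result (inj₁ found) = inj₁ (lift found)
    result (inj₂ fan) with any? (λ i → color i ≟ χ focus)
      where open Fan fan
    -- A focus with the color of a spoke prolongs that spoke downwards by one term; otherwise its
    -- color is new and gives another spoke.
    ... | yes (i , hit) = inj₁ (lift (ap (gap>0 i) (bounded i) extended))
      where
      open Fan fan
      extended : Mono χ (color i) focus (gap i) (suc len)
      extended {zero}  _  = trans (cong χ (+-identityʳ focus)) (sym hit)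
      extended {suc t} t< = trans (cong χ (sym (+-assoc focus (gap i) _)))
                                  (mono i (s<s⁻¹ t<))
    ... | no miss = inj₂ record
      { focus         = focus + e * W
      ; gap           = gap′
      ; color         = χ focus ◂ color
      ; gap>0         = λ { zero → <-≤-trans z<s (m≤n*m W D {{>-nonZero D>0}})
                          ; (suc i) → <-≤-trans (gap>0 i) (m≤m+n _ _) }
      ; bounded       = bounded′
      ; focus-bounded = +-mono-≤ focus-bounded eW≤VW
      ; distinct      = ◂-injective (λ i hit → miss (i , hit)) distinct
      ; mono          = mono′
      }
      where
      open Fan fan

      gap′ : Fin (suc s) → ℕ
      gap′ = D * W ◂ (λ i → gap i + D * W)

      bounded′ : ∀ i → focus + e * W + suc len * gap′ i ≤ N + V * W
      bounded′ zero = begin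
        focus + e * W + suc len * (D * W)  ≡⟨ regroup focus e W (suc len) D ⟩
        focus + (e + suc len * D) * W
          ≤⟨ +-mono-≤ focus-bounded (*-monoˡ-≤ W e+D≤V) ⟩
        N + V * W                          ∎
        where
        regroup : ∀ f e W k D → f + e * W + k * (D * W) ≡ f + (e + k * D) * W
        regroup = solve-∀
      bounded′ (suc i) = begin
        focus + e * W + suc len * (gap i + D * W)
          ≡⟨ regroup focus e W (suc len) (gap i) D ⟩
        focus + suc len * gap i + (e + suc len * D) * W
          ≤⟨ +-mono-≤ (bounded i) (*-monoˡ-≤ W e+D≤V) ⟩
        N + V * W  ∎
        where
        regroup : ∀ f e W k d D →
          f + e * W + k * (d + D * W) ≡ f + k * d + (e + k * D) * W
        regroup = solve-∀

      mono′ : ∀ i → Mono Δ ((χ focus ◂ color) i) (focus + e * W + gap′ i) (gap′ i) len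
      mono′ zero {t} t<len = trans
        (cong Δ (regroup focus e W t D))
        (transfer t<len (s≤s focus-bounded))
        where
        regroup : ∀ f e W t D → f + e * W + D * W + t * (D * W) ≡ f + (e + D + t * D) * W
        regroup = solve-∀
      mono′ (suc i) {t} t<len = trans
        (cong Δ (regroup focus e W t (gap i) D))
        (trans (transfer t<len (s≤s inside)) (mono i t<len))
        where
        regroup : ∀ f e W t d D → f + e * W + (d + D * W) + t * (d + D * W) ≡
          f + d + t * d + (e + D + t * D) * W
        regroup = solve-∀
        inside : focus + gap i + t * gap i ≤ N
        inside = begin
          focus + gap i + t * gap i   ≡⟨ +-assoc focus (gap i) _ ⟩
          focus + suc t * gap i
            ≤⟨ +-monoʳ-≤ focus (*-monoˡ-≤ (gap i) (m≤n⇒m≤1+n t<len)) ⟩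
          focus + suc len * gap i     ≤⟨ bounded i ⟩
          N                           ∎

-- Spokes are added one at a time, starting from the empty fan.
ap-or-fan : ∀ {len} → VanDerWaerden (suc len) → ∀ r s → AP-or-Fan r (suc len) s
ap-or-fan vdW r zero    = 0 , λ Δ → inj₂ record
  { focus         = 0
  ; gap           = λ ()
  ; color         = λ ()
  ; gap>0         = λ ()
  ; bounded       = λ ()
  ; focus-bounded = z≤n
  ; distinct      = λ { {()} }
  ; mono          = λ ()
  }
ap-or-fan vdW r (suc s) = add-spoke vdW (ap-or-fan vdW r s)

-- If unfolded, the enormous bounds would be evaluated during type checking.
opaque
  vanDerWaerden : ∀ len → VanDerWaerden (suc len)
  vanDerWaerden zero      r = 1 , λ Δ →
    ap {first = 0} {gap = 1} z<s ≤-refl (λ { {zero} _ → refl ; {suc _} (s≤s ()) })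
  -- A fan with `r + 1` spokes would need `r + 1` distinct colors, so only the progression remains.
  vanDerWaerden (suc len) r with ap-or-fan (vanDerWaerden len) r (suc r)
  ... | N , find = N , λ Δ → settle (find Δ)
    where
    settle : ∀ {Δ : ℕ → Fin r} →
      MonoAP Δ (suc (suc len)) N ⊎ Fan Δ (suc len) (suc r) N → MonoAP Δ (suc (suc len)) N
    settle (inj₁ found) = found
    settle (inj₂ fan)   = ⊥-elim (<⇒notInjective (n<1+n r) (Fan.distinct fan))

-- Towers of van der Waerden progressions

data Combination (p : ℕ) : List ℕ → ℕ → Set where
  []  : Combination p [] 0
  _∷_ : ∀ {a x xs s} → a ≤ p → Combination p xs s → Combination p (x ∷ xs) (a * x + s)

-- Each number carries its color so that the pigeonhole principle can select by it. The condition
-- `s < x` makes the numbers positive and, for `p` at least 1, strictly decreasing.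
data Tower {r} (Δ : ℕ → Fin r) (p : ℕ) : List (Fin r × ℕ) → Set where
  []  : Tower Δ p []
  _∷_ : ∀ {κ x ps} →
    (∀ {s} → Combination p (List.map proj₂ ps) s → s < x × Δ (x + s) ≡ κ) →
    Tower Δ p ps → Tower Δ p ((κ , x) ∷ ps)

Bounded : ∀ {r} → ℕ → ℕ → List (Fin r × ℕ) → Set
Bounded p N ps = ∀ {s} → Combination p (List.map proj₂ ps) s → s ≤ N

scale : ∀ {r} → ℕ → List (Fin r × ℕ) → List (Fin r × ℕ)
scale d = List.map (map₂ (_* d))

unscale : ∀ {r p s} d (ps : List (Fin r × ℕ)) →
  Combination p (List.map proj₂ (scale d ps)) s →
  ∃[ s′ ] (s ≡ s′ * d × Combination p (List.map proj₂ ps) s′)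
unscale d []             []                  = 0 , refl , []
unscale d ((_ , x) ∷ ps) (_∷_ {a} a≤p comb) with unscale d ps comb
... | s′ , refl , comb′ = a * x + s′ , eq , a≤p ∷ comb′
  where
  eq : a * (x * d) + s′ * d ≡ (a * x + s′) * d
  eq = sym (trans (*-distribʳ-+ d (a * x) s′) (cong (_+ s′ * d) (*-assoc a x d)))

-- Combinations commute with multiplication by `d`, so a tower inside the multiples of `d` is a
-- tower for `Δ`.
scale-tower : ∀ {r p d ps} {Δ : ℕ → Fin r} → 0 < d →
  Tower (λ j → Δ (j * d)) p ps → Tower Δ p (scale d ps)
scale-tower                       d>0 []           = []
scale-tower {p = p} {suc d} {(κ , x) ∷ ps} {Δ} d>0 (top ∷ tower) = top′ ∷ scale-tower d>0 tower
  where
  top′ : ∀ {s} → Combination p (List.map proj₂ (scale (suc d) ps)) s →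
    s < x * suc d × Δ (x * suc d + s) ≡ κ
  top′ comb with unscale (suc d) ps comb
  ... | s′ , refl , comb′ =
    *-monoˡ-< (suc d) (proj₁ (top comb′)) ,
    trans (cong Δ (sym (*-distribʳ-+ (suc d) x s′))) (proj₂ (top comb′))

tower : ∀ r p L → ∃[ N ] ∀ (Δ : ℕ → Fin r) →
  ∃[ ps ] (length ps ≡ L × Tower Δ p ps × Bounded p N ps)
tower r p zero    = 0 , λ Δ → [] , refl , [] , λ { [] → z≤n }
tower r p (suc L) with tower r p L
-- The progression has indices 0 to 2N + 1: `x` sits at index N + 1, which puts it above all lower
-- combinations (at most `N * d`), and N further terms contain `x` plus any of these.
... | N , find with vanDerWaerden (suc N + N) r
... | V , vdW = p * V + V , extend
  where
  extend : ∀ (Δ : ℕ → Fin r) →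
    ∃[ ps ] (length ps ≡ suc L × Tower Δ p ps × Bounded p (p * V + V) ps)
  extend Δ with vdW Δ
  ... | ap {c} {d} {κ} d>0 c≤V mono with find (λ j → Δ (j * d))
  ... | ps , len , low , low≤N =
    (κ , x) ∷ scale d ps , cong suc (trans (length-map _ ps) len) ,
    top ∷ scale-tower d>0 low , bounded
    where
    open ≤-Reasoning
    x : ℕ
    x = c + suc N * d

    top : ∀ {s} → Combination p (List.map proj₂ (scale d ps)) s → s < x × Δ (x + s) ≡ κ
    top comb with unscale d ps comb
    ... | s′ , refl , comb′ = below , trans (cong Δ eq) (mono (s≤s (+-monoʳ-≤ (suc N) s′≤N)))
      where
      s′≤N : s′ ≤ N
      s′≤N = low≤N comb′
      below : s′ * d < x
      below = begin-strict
        s′ * d          ≤⟨ *-monoˡ-≤ d s′≤N ⟩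
        N * d           <⟨ m<n+m (N * d) d>0 ⟩
        suc N * d       ≤⟨ m≤n+m _ c ⟩
        c + suc N * d   ∎
      eq : x + s′ * d ≡ c + (suc N + s′) * d
      eq = trans (+-assoc c (suc N * d) (s′ * d)) (cong (c +_) (sym (*-distribʳ-+ d (suc N) s′)))

    x≤V : x ≤ V
    x≤V = ≤-trans (+-monoʳ-≤ c (*-monoˡ-≤ d (m≤n⇒m≤1+n (m≤m+n (suc N) N)))) c≤V

    -- The multiple of `x` is at most `p * V`; the lower combination is below `x`, hence at most
    -- `V`.
    bounded : Bounded p (p * V + V) ((κ , x) ∷ scale d ps)
    bounded (a≤p ∷ comb) =
      +-mono-≤ (*-mono-≤ a≤p x≤V) (≤-trans (<⇒≤ (proj₁ (top comb))) x≤V)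

-- Terms missing from the sublist get coefficient zero.
Combination-⊆ : ∀ {p s xs ys} → xs ⊆ ys → Combination p xs s → Combination p ys s
Combination-⊆ []           []           = []
Combination-⊆ (y ∷ʳ xs⊆)   comb         = z≤n ∷ Combination-⊆ xs⊆ comb
Combination-⊆ (refl ∷ xs⊆) (a≤p ∷ comb) = a≤p ∷ Combination-⊆ xs⊆ comb

Tower-⊆ : ∀ {r p ps qs} {Δ : ℕ → Fin r} → ps ⊆ qs → Tower Δ p qs → Tower Δ p ps
Tower-⊆ []           []            = []
Tower-⊆ (_ ∷ʳ ps⊆)   (_ ∷ low)   = Tower-⊆ ps⊆ low
Tower-⊆ (refl ∷ ps⊆) (top ∷ low) =
  (λ comb → top (Combination-⊆ (Sublist.map⁺ proj₂ ps⊆) comb)) ∷ Tower-⊆ ps⊆ low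

-- The pigeonhole principle and monochromatic towers

length-filter-split : ∀ {A : Set} {P : A → Set} (P? : ∀ x → Dec (P x)) xs →
  length xs ≡ length (filter P? xs) + length (filter (¬? ∘ P?) xs)
length-filter-split P? [] = refl
length-filter-split P? (x ∷ xs) with ih ← length-filter-split P? xs | does (P? x)
... | true  = cong suc ih
... | false = trans (cong suc ih) (sym (+-suc _ _))

-- Induction on the admissible colors: if `κ` occurs at most `m` times, what is left is still too
-- long for the other colors. The result is a sublist, so its order is kept and a tower can be
-- restricted to it.
pigeonhole : ∀ {A : Set} {r} (f : A → Fin r) (κs : List (Fin r)) m (xs : List A) →
  All (λ x → f x ∈ κs) xs → length κs * m < length xs →
  ∃[ κ ] ∃[ ys ] (ys ⊆ xs × All (λ y → f y ≡ κ) ys × length ys ≡ suc m)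
pigeonhole f []       m (x ∷ xs) (() ∷ _) _
pigeonhole f (κ ∷ κs) m xs covered large = split (≤-<-connex (length hits) m)
  where
  hit? = λ x → f x ≟ κ
  hits = filter hit? xs
  misses = filter (¬? ∘ hit?) xs

  split : length hits ≤ m ⊎ m < length hits →
    ∃[ κ ] ∃[ ys ] (ys ⊆ xs × All (λ y → f y ≡ κ) ys × length ys ≡ suc m)
  split (inj₂ many) =
    κ , take (suc m) hits ,
    ⊆-trans (Sublist.take-⊆ (suc m) hits) (Sublist.filter-⊆ hit? xs) ,
    All.take⁺ (suc m) (All.all-filter hit? xs) ,
    trans (length-take (suc m) hits) (m≤n⇒m⊓n≡m many)
  split (inj₁ few) with pigeonhole f κs m misses covered′ large′
    where
    open ≤-Reasoning
    covered′ : All (λ x → f x ∈ κs) misses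
    covered′ = All.zipWith
      (λ { (miss , here eq) → contradiction eq miss ; (_ , there ∈κs) → ∈κs })
      (All.all-filter (¬? ∘ hit?) xs , All.filter⁺ (¬? ∘ hit?) covered)
    large′ : length κs * m < length misses
    large′ = +-cancelˡ-< m _ _ (begin-strict
      m + length κs * m              <⟨ large ⟩
      length xs                      ≡⟨ length-filter-split hit? xs ⟩
      length hits + length misses    ≤⟨ +-monoˡ-≤ _ few ⟩
      m + length misses              ∎)
  ... | κ′ , ys , ys⊆ , rest =
    κ′ , ys , ⊆-trans ys⊆ (Sublist.filter-⊆ (¬? ∘ hit?) xs) , rest

monochromatic-tower : ∀ r p m → ∃[ N ] ∀ (Δ : ℕ → Fin r) → ∃[ κ ] ∃[ ps ]
  (All (λ q → proj₁ q ≡ κ) ps × length ps ≡ suc m × Tower Δ p ps × Bounded p N ps)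
monochromatic-tower r p m = N , λ Δ →
  let qs , len , tow , qs≤N = find Δ
      κ , ps , ps⊆ , same , len′ = pigeonhole proj₁ (allFin r) m qs
        (All.universal (λ q → ∈-allFin (proj₁ q)) qs) (enough len)
  in κ , ps , same , len′ , Tower-⊆ ps⊆ tow ,
     (λ comb → qs≤N (Combination-⊆ (Sublist.map⁺ proj₂ ps⊆) comb))
  where
  N = proj₁ (tower r p (suc (r * m)))
  find = proj₂ (tower r p (suc (r * m)))
  enough : ∀ {n} → n ≡ suc (r * m) → length (allFin r) * m < n
  enough refl = ≤-reflexive (cong (λ l → suc (l * m)) (length-tabulate {n = r} id))

-- Special combinations and the numbers in a tower

zero-combination : ∀ {p} xs → Combination p xs 0
zero-combination []       = []
zero-combination (x ∷ xs) = z≤n ∷ zero-combination xs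

sum-combination : ∀ {p} xs → 1 ≤ p → Combination p xs (sum xs)
sum-combination []       _   = []
sum-combination (x ∷ xs) 1≤p =
  subst (λ y → Combination _ (x ∷ xs) (y + sum xs)) (*-identityˡ x)
    (1≤p ∷ sum-combination xs 1≤p)

∈-combination : ∀ {p x xs} → 1 ≤ p → x ∈ xs → Combination p xs x
∈-combination {x = x} {_ ∷ xs} 1≤p (here refl) =
  subst (Combination _ (x ∷ xs)) (trans (+-identityʳ _) (*-identityˡ x))
    (1≤p ∷ zero-combination xs)
∈-combination 1≤p (there x∈) = z≤n ∷ ∈-combination 1≤p x∈

module _ {r p : ℕ} {Δ : ℕ → Fin r} where

  -- Adding the zero combination to `x` shows the color of `x` itself.
  tower-colored : ∀ {κ ps} → All (λ q → proj₁ q ≡ κ) ps → Tower Δ p ps →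
    All (λ x → Δ x ≡ κ) (List.map proj₂ ps)
  tower-colored []           []          = []
  tower-colored {ps = (_ , x) ∷ _} (refl ∷ same) (top ∷ tow) =
    trans (cong Δ (sym (+-identityʳ x))) (proj₂ (top (zero-combination _))) ∷
    tower-colored same tow

  tower-positive : ∀ {ps} → Tower Δ p ps → All (0 <_) (List.map proj₂ ps)
  tower-positive []          = []
  tower-positive (top ∷ tow) = proj₁ (top (zero-combination _)) ∷ tower-positive tow

  -- Every later number is itself a combination, hence below `x`.
  tower-decreasing : ∀ {ps} → 1 ≤ p → Tower Δ p ps → AllPairs _>_ (List.map proj₂ ps)
  tower-decreasing 1≤p []          = []
  tower-decreasing 1≤p (top ∷ tow) =
    All.tabulate (λ x∈ → proj₁ (top (∈-combination 1≤p x∈))) ∷ tower-decreasing 1≤p tow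

-- Solutions with prescribed summands

∈⇒≤sum : ∀ {x xs} → x ∈ xs → x ≤ sum xs
∈⇒≤sum {xs = y ∷ xs} (here refl) = m≤m+n y (sum xs)
∈⇒≤sum {xs = y ∷ xs} (there x∈)  = m≤n⇒m≤o+n y (∈⇒≤sum x∈)

sum-replicate-++ : ∀ j x ys → sum (replicate j x ++ ys) ≡ j * x + sum ys
sum-replicate-++ zero    x ys = refl
sum-replicate-++ (suc j) x ys =
  trans (cong (x +_) (sum-replicate-++ j x ys)) (sym (+-assoc x (j * x) (sum ys)))

sum-toList : ∀ {k} (v : Vec ℕ k) → Vec.sum v ≡ sum (Vec.toList v)
sum-toList []      = refl
sum-toList (x ∷ v) = cong (x +_) (sum-toList v)

-- Inverse of `value`, made total so that a coloring of {1,...,N+1} becomes one of all of ℕ. The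
-- results at 0 and above N + 1 are mere defaults.
clamp : ∀ {N} → ℕ → Fin (suc N)
clamp     zero    = zero
clamp {N} (suc m) = fromℕ< (s≤s (m⊓n≤n m N))

value-clamp : ∀ {N m} → 0 < m → m ≤ suc N → value (clamp {N} m) ≡ m
value-clamp {N} {suc m} _ (s≤s m≤N) =
  cong suc (trans (toℕ-fromℕ< (s≤s (m⊓n≤n m N))) (m≤n⇒m⊓n≡m m≤N))

-- Each summand is positive and at most the sum, so `clamp` preserves all the numbers and hence the
-- equation.
solution : ∀ {N k} (xs : List ℕ) → length xs ≡ k → 0 < k → All (0 <_) xs → sum xs ≤ suc N →
  Σ[ S ∈ Solution k (suc N) ] entries S ≡ List.map clamp (sum xs ∷ xs)
solution {N} xs@(x ∷ _) refl _ pos@(x>0 ∷ _) sum≤ = record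
  { summands = summands′
  ; total    = clamp (sum xs)
  ; equation = equation′
  } , cong (clamp (sum xs) ∷_) toList-summands
  where
  open ≡-Reasoning
  summands′ = Vec.map clamp (Vec.fromList xs)

  toList-summands : Vec.toList summands′ ≡ List.map clamp xs
  toList-summands = trans (Vec.toList-map clamp (Vec.fromList xs))
                          (cong (List.map clamp) (Vec.toList∘fromList xs))

  in-range : All (λ y → value (clamp {N} y) ≡ y) xs
  in-range = All.tabulate λ y∈ →
    value-clamp (All.lookup pos y∈) (≤-trans (∈⇒≤sum y∈) sum≤)

  equation′ : Vec.sum (Vec.map value summands′) ≡ value (clamp {N} (sum xs))
  equation′ = begin
    Vec.sum (Vec.map value summands′)                ≡⟨ sum-toList (Vec.map value summands′) ⟩
    sum (Vec.toList (Vec.map value summands′))  ≡⟨ cong sum (Vec.toList-map value summands′) ⟩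
    sum (List.map value (Vec.toList summands′)) ≡⟨ cong (sum ∘ List.map value) toList-summands ⟩
    sum (List.map value (List.map clamp xs))    ≡⟨ cong sum (map-∘ {g = value} {f = clamp} xs) ⟨
    sum (List.map (value ∘ clamp {N}) xs)       ≡⟨ cong sum (map-id-local in-range) ⟩
    sum xs
      ≡⟨ value-clamp (≤-trans x>0 (∈⇒≤sum {xs = xs} (here refl))) sum≤ ⟨
    value (clamp {N} (sum xs))                  ∎

-- Counting distinct entries

module _ {A : Set} (_≟_ : (x y : A) → Dec (x ≡ y)) where

  deduplicate-unique : ∀ {xs} → Unique xs → deduplicate _≟_ xs ≡ xs
  deduplicate-unique []             = refl
  deduplicate-unique {x ∷ xs} (x∉ ∷ xs!) = cong (x ∷_)
    (trans (cong (filter _) (deduplicate-unique xs!)) (filter-all (¬? ∘ (x ≟_)) x∉))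

  deduplicate-replicate : ∀ j x xs →
    deduplicate _≟_ (replicate j x ++ x ∷ xs) ≡ deduplicate _≟_ (x ∷ xs)
  deduplicate-replicate zero    x xs = refl
  deduplicate-replicate (suc j) x xs = cong (x ∷_) (trans
    (cong (filter x≢?) (deduplicate-replicate j x xs))
    (trans (filter-reject x≢? (λ x≢x → x≢x refl)) (filter-idem x≢? (deduplicate _≟_ xs))))
    where x≢? = ¬? ∘ (x ≟_)

  deduplicate-++-cong : ∀ zs {xs ys} → deduplicate _≟_ xs ≡ deduplicate _≟_ ys →
    deduplicate _≟_ (zs ++ xs) ≡ deduplicate _≟_ (zs ++ ys)
  deduplicate-++-cong []       eq = eq
  deduplicate-++-cong (z ∷ zs) eq = cong (λ ds → z ∷ filter _ ds) (deduplicate-++-cong zs eq)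

  -- Besides `t` only one distinct value is left, and all of `xs` must equal it.
  two-values : ∀ {t x y xs} → length (deduplicate _≟_ (t ∷ xs)) ≡ 2 → All (_≢ t) xs →
    x ∈ xs → y ∈ xs → x ≡ y
  two-values {t} {x} {y} {xs} len ≢t x∈ y∈ = singleton (suc-injective len) (others x∈) (others y∈)
    where
    rest = filter (¬? ∘ (t ≟_)) (deduplicate _≟_ xs)
    others : ∀ {z} → z ∈ xs → z ∈ rest
    others z∈ = ∈-filter⁺ (¬? ∘ (t ≟_)) (∈-deduplicate⁺ _≟_ z∈) (≢-sym (All.lookup ≢t z∈))
    singleton : ∀ {zs} → length zs ≡ 1 → x ∈ zs → y ∈ zs → x ≡ y
    singleton {_ ∷ []} _ (here refl) (here refl) = refl

module _ {N : ℕ} where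

  count-clamped : ∀ zs j x xs → All (0 <_) (zs ++ x ∷ xs) → All (_≤ suc N) (zs ++ x ∷ xs) →
    Unique (zs ++ x ∷ xs) →
    length (deduplicate _≟_ (List.map (clamp {N}) (zs ++ replicate j x ++ x ∷ xs))) ≡
      length (zs ++ x ∷ xs)
  count-clamped zs j x xs pos ≤N xs! = begin
    length (deduplicate _≟_ (List.map clamp (zs ++ replicate j x ++ x ∷ xs)))
      ≡⟨ cong (length ∘ deduplicate _≟_) (trans (map-++ clamp zs _) (cong (List.map clamp zs ++_)
           (trans (map-++ clamp (replicate j x) (x ∷ xs))
                  (cong (_++ List.map clamp (x ∷ xs)) (map-replicate clamp j x))))) ⟩
    length (deduplicate _≟_ (List.map clamp zs ++ replicate j (clamp x) ++ List.map clamp (x ∷ xs)))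
      ≡⟨ cong length (deduplicate-++-cong _≟_ (List.map clamp zs)
           (deduplicate-replicate _≟_ j (clamp x) _)) ⟩
    length (deduplicate _≟_ (List.map clamp zs ++ List.map clamp (x ∷ xs)))
      ≡⟨ cong (length ∘ deduplicate _≟_) (map-++ clamp zs (x ∷ xs)) ⟨
    length (deduplicate _≟_ (List.map clamp (zs ++ x ∷ xs)))
      ≡⟨ cong length (deduplicate-unique _≟_ clamped!) ⟩
    length (List.map (clamp {N}) (zs ++ x ∷ xs))
      ≡⟨ length-map clamp (zs ++ x ∷ xs) ⟩
    length (zs ++ x ∷ xs) ∎
    where
    open ≡-Reasoning
    clamped! : Unique (List.map (clamp {N}) (zs ++ x ∷ xs))
    -- `value` undoes `clamp` on this range, so equal clamped numbers were equal before.
    clamped! = Unique.map⁻ {f = value} (subst Unique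
      (trans (sym (map-id-local (All.zipWith (λ (m>0 , m≤) → value-clamp m>0 m≤) (pos , ≤N))))
             (map-∘ (zs ++ x ∷ xs)))
      xs!)

All-replicate-++ : ∀ {A : Set} {P : A → Set} j {x xs} →
  All P (x ∷ xs) → All P (replicate j x ++ x ∷ xs)
All-replicate-++ j ps@(px ∷ _) = All.++⁺ (All.replicate⁺ j px) ps

-- Existence for ℓ ≥ 2

exists-ℓ≥2 : ∀ r {k ℓ} → 2 ≤ ℓ → ℓ ≤ k → S-Exists r k ℓ
-- The tower has ℓ = m + 2 numbers. Coefficients up to `k` suffice because `x₂` occurs `j + 1`
-- times, at most `k`, and the others once.
exists-ℓ≥2 r {k} {suc (suc m)} (s≤s (s≤s z≤n)) ℓ≤k with monochromatic-tower r k (suc m)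
... | N , find = suc N , z<s , forces
  where
  j = k ∸ (2 + m)
  1≤k : 1 ≤ k
  1≤k = ≤-trans z<s ℓ≤k

  forces : Forces r k (2 + m) (suc N)
  forces Δ with find (Δ ∘ clamp)
  ... | κ , (κ₁ , x₁) ∷ (κ₂ , x₂) ∷ ps , same@(refl ∷ _) , len , tow@(top ∷ _) , ≤N =
    S , (κ , subst (All (λ i → Δ i ≡ κ)) (sym S-entries) (All.map⁺ colored)) , distinct-count
    where
    open ≤-Reasoning
    rest = List.map proj₂ ps
    summands′ = x₁ ∷ replicate j x₂ ++ x₂ ∷ rest
    total′ = sum summands′

    lower-combination : Combination k (x₂ ∷ rest) (sum (replicate j x₂ ++ x₂ ∷ rest))
    lower-combination = subst (Combination k (x₂ ∷ rest)) eq
      (repeats≤k ∷ sum-combination rest 1≤k)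
      where
      repeats≤k : suc j ≤ k
      repeats≤k = begin
        suc j             ≤⟨ +-monoˡ-≤ j (s≤s z≤n) ⟩
        2 + m + j         ≡⟨ m+[n∸m]≡n ℓ≤k ⟩
        k                 ∎
      eq : suc j * x₂ + sum rest ≡ sum (replicate j x₂ ++ x₂ ∷ rest)
      eq = begin-equality
        x₂ + j * x₂ + sum rest    ≡⟨ cong (_+ sum rest) (+-comm x₂ (j * x₂)) ⟩
        j * x₂ + x₂ + sum rest    ≡⟨ +-assoc (j * x₂) x₂ _ ⟩
        j * x₂ + (x₂ + sum rest)  ≡⟨ sum-replicate-++ j x₂ (x₂ ∷ rest) ⟨
        sum (replicate j x₂ ++ x₂ ∷ rest) ∎

    positive : All (0 <_) (x₁ ∷ x₂ ∷ rest)
    positive = tower-positive tow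

    decreasing : AllPairs _>_ (x₁ ∷ x₂ ∷ rest)
    decreasing = tower-decreasing 1≤k tow

    colors : All (λ x → Δ (clamp x) ≡ κ) (x₁ ∷ x₂ ∷ rest)
    colors = tower-colored same tow

    colored : All (λ x → Δ (clamp x) ≡ κ) (total′ ∷ summands′)
    -- The total is `x₁` plus a lower combination, so the tower gives it the color of `x₁`.
    colored = proj₂ (top lower-combination) ∷ All.head colors ∷ All-replicate-++ j (All.tail colors)

    total≤ : total′ ≤ suc N
    total≤ = m≤n⇒m≤1+n (≤N (subst
      (λ y → Combination k (x₁ ∷ x₂ ∷ rest) (y + sum (replicate j x₂ ++ x₂ ∷ rest)))
      (*-identityˡ x₁) (1≤k ∷ lower-combination)))

    x₁<total : x₁ < total′
    x₁<total = m<m+n x₁ (<-≤-trans (All.head (All.tail positive))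
      (∈⇒≤sum (∈-++⁺ʳ (replicate j x₂) (here refl))))

    total>each : All (_< total′) (x₁ ∷ x₂ ∷ rest)
    total>each = x₁<total ∷ All.map (λ <x₁ → <-trans <x₁ x₁<total) (AllPairs.head decreasing)

    -- The total lies above the ℓ decreasing numbers, which makes ℓ + 1 distinct values.
    all-distinct : Unique (total′ ∷ x₁ ∷ x₂ ∷ rest)
    all-distinct = AllPairs.map >⇒≢ (total>each ∷ decreasing)

    length-summands : length summands′ ≡ k
    length-summands = begin-equality
      suc (length (replicate j x₂ ++ x₂ ∷ rest))        ≡⟨ cong suc (length-++ (replicate j x₂)) ⟩
      suc (length (replicate j x₂) + suc (length rest)) ≡⟨ cong₂ (λ a b → suc (a + b))
          (length-replicate j) (trans (cong suc (length-map proj₂ ps)) (suc-injective len)) ⟩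
      suc (j + suc m)                                   ≡⟨ cong suc (+-comm j (suc m)) ⟩
      2 + m + j                                         ≡⟨ m+[n∸m]≡n ℓ≤k ⟩
      k                                                 ∎

    built = solution {N} summands′ length-summands 1≤k
      (All.head positive ∷ All-replicate-++ j (All.tail positive)) total≤
    S = proj₁ built
    S-entries = proj₂ built

    distinct-count : c S ≡ suc (2 + m)
    distinct-count = begin-equality
      c S ≡⟨ cong (length ∘ deduplicate _≟_) S-entries ⟩
      length (deduplicate _≟_ (List.map clamp (total′ ∷ summands′)))
        ≡⟨ count-clamped (total′ ∷ x₁ ∷ []) j x₂ rest
             (<-trans (All.head positive) x₁<total ∷ positive)
             (total≤ ∷ All.map (λ < → ≤-trans (<⇒≤ <) total≤) total>each)
             all-distinct ⟩
      suc (length (x₁ ∷ x₂ ∷ rest))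
        ≡⟨ cong suc (length-map proj₂ ((κ₁ , x₁) ∷ (κ₂ , x₂) ∷ ps)) ⟩
      suc (length ((κ₁ , x₁) ∷ (κ₂ , x₂) ∷ ps)) ≡⟨ cong suc len ⟩
      suc (2 + m)  ∎

-- Existence for one color and ℓ = 1

Fin1-trivial : (i j : Fin 1) → i ≡ j
Fin1-trivial zero zero = refl

exists-one-color : ∀ {k} → 2 ≤ k → S-Exists 1 k 1
exists-one-color {suc (suc k)} (s≤s (s≤s z≤n)) = suc N , z<s , forces
  where
  -- The solution 1 + ⋯ + 1 = N has two distinct values, as there are at least two summands.
  summands′ = replicate (suc k) 1 ++ 1 ∷ []
  N = sum summands′
  positive : All (0 <_) summands′
  positive = All-replicate-++ (suc k) (z<s ∷ [])
  1<N : 1 < N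
  1<N = s≤s (≤-trans (m≤n+m 1 (k * 1)) (≤-reflexive (sym (sum-replicate-++ k 1 (1 ∷ [])))))
  length-summands : length summands′ ≡ 2 + k
  length-summands = trans (length-++ (replicate (suc k) 1))
    (trans (cong (_+ 1) (length-replicate (suc k))) (+-comm (suc k) 1))
  built = solution {N} summands′ length-summands z<s positive (n≤1+n N)
  S = proj₁ built
  forces : Forces 1 (2 + k) 1 (suc N)
  forces Δ = S , (zero , All.universal (λ i → Fin1-trivial (Δ i) zero) (entries S)) ,
    trans (cong (length ∘ deduplicate _≟_) (proj₂ built))
      (count-clamped (N ∷ []) (suc k) 1 []
        (<-trans z<s 1<N ∷ z<s ∷ []) (n≤1+n N ∷ s≤s z≤n ∷ [])
        ((>⇒≢ 1<N ∷ []) ∷ [] ∷ []))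

-- A coloring without monochromatic solutions of ℓ = 1

module Valuation (k : ℕ) (2≤k : 2 ≤ k) where

  -- The parity of the exponent of k in x > 0, provided that the fuel is at least x.
  exponent-parity-fuelled : ℕ → ℕ → Bool
  exponent-parity-fuelled zero       x = false
  exponent-parity-fuelled (suc fuel) x with k ∣? x
  ... | yes (divides q _) = not (exponent-parity-fuelled fuel q)
  ... | no _              = false

  quotient-bounds : ∀ {x q} → 0 < x → x ≡ q * k → 0 < q × q < x
  quotient-bounds {x} {suc q} _ refl = z<s , m<m*n (suc q) k 2≤k

  -- The recursion passes to a quotient strictly below `x`, so fuel `x` never runs out.
  exponent-parity-fuelled-irrelevant : ∀ {f g x} → 0 < x → x ≤ f → x ≤ g →
    exponent-parity-fuelled f x ≡ exponent-parity-fuelled g x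
  exponent-parity-fuelled-irrelevant {zero} x>0 x≤0 _ = contradiction x≤0 (<⇒≱ x>0)
  exponent-parity-fuelled-irrelevant {suc _} {zero} x>0 _ x≤0 = contradiction x≤0 (<⇒≱ x>0)
  exponent-parity-fuelled-irrelevant {suc f} {suc g} {x} x>0 x≤f x≤g with k ∣? x
  ... | no _               = refl
  ... | yes (divides q eq) with quotient-bounds x>0 eq
  ...   | q>0 , q<x = cong not (exponent-parity-fuelled-irrelevant q>0
          (s≤s⁻¹ (≤-trans q<x x≤f)) (s≤s⁻¹ (≤-trans q<x x≤g)))

  exponent-parity : ℕ → Bool
  exponent-parity x = exponent-parity-fuelled x x

  -- A factor `k` raises the exponent by one.
  exponent-parity-* : ∀ {x} → 0 < x → exponent-parity (k * x) ≡ not (exponent-parity x)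
  exponent-parity-* {x} x>0 = trans
    -- One extra unit of fuel exposes a recursion step, since `k * x` is not syntactically a
    -- successor.
    (exponent-parity-fuelled-irrelevant kx>0 ≤-refl (n≤1+n (k * x)))
    unfold
    where
    k>0 : 0 < k
    k>0 = <-trans z<s 2≤k
    instance
      k≢0 : NonZero k
      k≢0 = >-nonZero k>0
    kx>0 : 0 < k * x
    kx>0 = *-mono-≤ k>0 x>0
    unfold : exponent-parity-fuelled (suc (k * x)) (k * x) ≡ not (exponent-parity x)
    unfold with k ∣? (k * x)
    ... | no k∤ = contradiction (m∣m*n x) k∤
    ... | yes (divides q eq) with *-cancelʳ-≡ x q k (trans (*-comm x k) eq)
    ...   | refl = cong not (exponent-parity-fuelled-irrelevant x>0 (m≤n*m x k) ≤-refl)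

sum-constant : ∀ {k y} (v : Vec ℕ k) → (∀ {x} → x ∈ Vec.toList v → x ≡ y) →
  Vec.sum v ≡ k * y
sum-constant []      _   = refl
sum-constant (x ∷ v) all = cong₂ _+_ (all (here refl)) (sum-constant v (all ∘ there))

value≤sum : ∀ {k n} (v : Vec (Fin n) k) {i} → i ∈ Vec.toList v →
  value i ≤ Vec.sum (Vec.map value v)
value≤sum (j ∷ v) (here refl) = m≤m+n (value j) _
value≤sum (j ∷ v) (there i∈)  = m≤n⇒m≤o+n (value j) (value≤sum v i∈)

value<sum : ∀ {k n} (v : Vec (Fin n) (2 + k)) {i} → i ∈ Vec.toList v →
  value i < Vec.sum (Vec.map value v)
value<sum (a ∷ b ∷ v) (here refl) = m<m+n (value a) z<s
value<sum (a ∷ b ∷ v) (there i∈)  = ≤-<-trans (value≤sum (b ∷ v) i∈) (m<n+m _ z<s)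

summand<total : ∀ {k n} (S : Solution (2 + k) n) {i} → i ∈ Vec.toList (summands S) →
  value i < value (total S)
summand<total S {i} i∈ = subst (value i <_) (equation S) (value<sum (summands S) i∈)

head∈toList : ∀ {A : Set} {m} (v : Vec A (suc m)) → Vec.head v ∈ Vec.toList v
head∈toList (_ ∷ _) = here refl

-- The total exceeds every summand, so it is one of the two values and all summands share the other.
total-c≡2 : ∀ {k n} (S : Solution (2 + k) n) → c S ≡ 2 →
  value (total S) ≡ (2 + k) * value (Vec.head (summands S))
total-c≡2 {k} S c≡2 = trans (sym (equation S))
  (sum-constant (Vec.map value (summands S)) all-equal)
  where
  all-equal : ∀ {x} → x ∈ Vec.toList (Vec.map value (summands S)) →
    x ≡ value (Vec.head (summands S))
  all-equal {x} x∈ with ∈-map⁻ value (subst (x ∈_) (Vec.toList-map value (summands S)) x∈)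
  ... | i , i∈ , refl = cong value (two-values _≟_ c≡2
    (All.tabulate λ j∈ → λ { refl → <-irrefl refl (summand<total S j∈) })
    i∈ (head∈toList (summands S)))

no-monochromatic : ∀ {r k n} → 2 ≤ r → 2 ≤ k → ¬ Forces r k 1 n
no-monochromatic {suc (suc r)} {suc (suc k)} (s≤s (s≤s z≤n)) 2≤k@(s≤s (s≤s z≤n)) forces =
  refute (forces (λ i → paint (exponent-parity (value i))))
  where
  open Valuation (2 + k) 2≤k

  paint : Bool → Fin (2 + r)
  paint false = zero
  paint true  = suc zero

  paint-injective : ∀ {a b} → paint a ≡ paint b → a ≡ b
  paint-injective {false} {false} _ = refl
  paint-injective {true}  {true}  _ = refl

  refute : ¬ (Σ[ S ∈ Solution (2 + k) _ ]
    (Monochromatic (λ i → paint (exponent-parity (value i))) S × c S ≡ 2))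
  refute (S , (κ , total-κ ∷ summands-κ) , c≡2) = not-¬
    -- A common color would equate the parities for the total and the first summand, yet a factor of
    -- `2 + k` flips the parity.
    (paint-injective (trans total-κ (sym (All.lookup summands-κ (head∈toList (summands S))))))
    (trans (cong exponent-parity (total-c≡2 S c≡2))
           (exponent-parity-* {value (Vec.head (summands S))} z<s))

theorem2p4 : (k ℓ r : ℕ) → 1 ≤ ℓ → 1 ≤ r → ℓ ≤ k → 2 ≤ k →
    S-Exists r k ℓ ⇔ (2 ≤ ℓ ⊎ r ≡ 1)
theorem2p4 k ℓ r 1≤ℓ 1≤r ℓ≤k 2≤k = mk⇔ (necessary 1≤ℓ 1≤r) sufficient
  where
  necessary : ∀ {ℓ r} → 1 ≤ ℓ → 1 ≤ r → S-Exists r k ℓ → 2 ≤ ℓ ⊎ r ≡ 1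
  necessary {suc (suc _)}                   _ _ _                = inj₁ (s≤s z<s)
  necessary {suc zero}    {suc zero}        _ _ _                = inj₂ refl
  necessary {suc zero}    {r@(suc (suc _))} _ _ (_ , _ , forces) =
    ⊥-elim (no-monochromatic {r} (s≤s z<s) 2≤k forces)

  sufficient : 2 ≤ ℓ ⊎ r ≡ 1 → S-Exists r k ℓ
  sufficient (inj₁ 2≤ℓ) = exists-ℓ≥2 r 2≤ℓ ℓ≤k
  sufficient (inj₂ refl) with m≤n⇒m<n∨m≡n 1≤ℓ
  ... | inj₁ 2≤ℓ  = exists-ℓ≥2 r 2≤ℓ ℓ≤k
  ... | inj₂ refl = exists-one-color 2≤k
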